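{- Let $\mathbb{F}$ be any field and let $n,d\ge 1$. For every $n^d\times n^d$ matrix $M$ over $\mathbb{F}$, \[ \mathcal{L}_{\mathsf{sm}}\big(\mathrm{ShiftedTensor}(M)\big)\;\ge\;\frac{\mathrm{PT\text{ - }rank}(M)}{n^{\,d-\log_2 d+1}}. \] Equivalently, every syntactically set-multilinear arithmetic formula computing the set-multilinear polynomial \[ \widetilde Q_M=\sum_{\vec i,\vec j\in[n]^d} M_{\vec i,\vec j}\,\widetilde X^{(0)}_{i_1}\widetilde X^{(1)}_{j_1,i_2}\cdots\widetilde X^{(d-1)}_{j_{d-1},i_d}\widetilde X^{(d)}_{j_d} \] (with respect to the $d+1$ variable blocks $\widetilde X^{(0)},\dots,\widetilde X^{(d)}$) has at least $\mathrm{PT\text{ - }rank}(M)/n^{d-\log_2 d+1}$ leaves.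
   Context: Rows and columns of an $n^d\times n^d$ matrix $M$ are indexed by $d$-tuples in $[n]^d$. For $k\in[d]$ the $k$-th partial transpose is $M^{\top_k}_{(i_1,\dots,i_d),(j_1,\dots,j_d)}=M_{(i_1,\dots,i_{k-1},j_k,i_{k+1},\dots,i_d),(j_1,\dots,j_{k-1},i_k,j_{k+1},\dots,j_d)}$; for $\kappa\subseteq[d]$, $M^{\top_\kappa}$ is the composition of the (commuting) $\top_k$, $k\in\kappa$. $M$ is PT-basic if $\mathrm{rank}(M^{\top_\kappa})=1$ for some $\kappa\subseteq[d]$; $\mathrm{PT\text{ - }rank}(M)$ is the minimum number of PT-basic matrices summing to $M$. Pairing: $\langle i,j\rangle=(i-1)n+j$, a bijection $[n]^2\to[n^2]$. $\mathrm{ShiftedTensor}(M):[n^2]^{d+1}\to\mathbb{F}$ is defined by $\mathrm{ShiftedTensor}(M)(\langle p,i_1\rangle,\langle j_1,i_2\rangle,\dots,\langle j_{d-1},i_d\rangle,\langle j_d,q\rangle)=\mathbb 1\{p=q=1\}\,M_{(i_1,\dots,i_d),(j_1,\dots,j_d)}$. Set-multilinear formula size: for a nonempty finite set $D$ and a tensor $A:[N]^D\to\mathbb{F}$, $\mathcal L_{\mathsf{sm}}(A)$ is defined inductively: if $|D|=1$, it is $1$ if $A\neq 0$ and $0$ otherwise; if $|D|\ge 2$, it is the minimum of $\sum_i(\mathcal L_{\mathsf{sm}}(B_i)+\mathcal L_{\mathsf{sm}}(C_i))$ over finite families $(E_i,F_i,B_i,C_i)$ with $E_i,F_i$ disjoint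 nonempty, $E_i\cup F_i=D$, $B_i:[N]^{E_i}\to\mathbb{F}$, $C_i:[N]^{F_i}\to\mathbb{F}$ and $A=\sum_i B_i\otimes C_i$. This equals the minimum number of leaves of a syntactically set-multilinear formula computing $\sum_{a\in[N]^D}A(a)\prod_{k\in D}X^{(k)}_{a_k}$. Logarithms are base 2. -}

module Defs where

open import Level using (Level; _⊔_)
open import Algebra.Apartness.Bundles using (HeytingField; HeytingCommutativeRing)
open import Algebra.Bundles using (CommutativeRing)
import Algebra.Definitions.RawMonoid as RawMonoidSum
open import Data.Bool.Base using (if_then_else_)
open import Data.Fin.Base using (Fin; zero; suc; toℕ; remQuot)
open import Data.Fin.Subset
  using (Subset; inside; outside; _∈_; _⊆_; _∪_; _∩_; ∣_∣; ⁅_⁆; Nonempty; Empty)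
  renaming (⊤ to Full; ⊥ to ∅)
open import Data.Fin.Subset.Properties
  using (p⊆p∪q; q⊆p∪q; x∈p∩q⁺; x∈⁅x⁆; p⊂q⇒∣p∣<∣q∣; drop-∷-⊆)
open import Data.List.Base using (foldr; allFin)
open import Data.Nat.Base as ℕ using (ℕ; zero; suc; _≤_; _<_; NonZero; +-0-rawMonoid)
open import Data.Nat.Induction using (<-wellFounded)
open import Data.Nat.Properties using (_≟_)
open import Data.Product.Base using (Σ-syntax; ∃-syntax; _×_; _,_; proj₁; proj₂)
open import Data.Sum.Base using (_⊎_)
open import Data.Unit.Base using (⊤; tt)
open import Data.Vec.Base as Vec
  using (Vec; []; _∷_; lookup; _[_]≔_; head; tail; init; last; here; there)
open import Induction.WellFounded using (Acc; acc)
open import Relation.Binary.PropositionalEquality using (_≡_; refl; subst)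
open import Relation.Nullary.Decidable.Core using (⌊_⌋)
open import Relation.Nullary.Negation.Core using (¬_)

private
  variable
    a : Level
    m : ℕ

sumℕ : ∀ {t} → (Fin t → ℕ) → ℕ
sumℕ = RawMonoidSum.sum +-0-rawMonoid

IsMinimum : (ℕ → Set a) → ℕ → Set a
IsMinimum P l = P l × (∀ s → P s → l ≤ s)

-- The real inequality  r / n^(d - log₂ e + 1) ≤ l,  for n , e ≥ 1.  Clearing the
-- denominator it says  r · n^(log₂ e) ≤ l · n^(d+1).  Since n ≥ 1 and log₂ e ≥ 0,
-- the real power n^(log₂ e) is the supremum of the n^(p/q) over the rationals
-- 0 ≤ p/q ≤ log₂ e, i.e. those with 2^p ≤ e^q; raising to the q-th power removes
-- the remaining root.
_/_^[_-log₂_+1]≤_ : ℕ → ℕ → ℕ → ℕ → ℕ → Set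
r / n ^[ d -log₂ e +1]≤ l =
  ∀ p q → .{{NonZero q}} → 2 ℕ.^ p ≤ e ℕ.^ q →
  r ℕ.^ q ℕ.* n ℕ.^ p ≤ (l ℕ.* n ℕ.^ (d ℕ.+ 1)) ℕ.^ q

-- Tuple B D is the product of the B k over k ∈ D.
Tuple : (Fin m → Set) → Subset m → Set
Tuple B []            = ⊤
Tuple B (inside  ∷ D) = B zero × Tuple (λ k → B (suc k)) D
Tuple B (outside ∷ D) = Tuple (λ k → B (suc k)) D

component : ∀ {B : Fin m → Set} {D k} → k ∈ D → Tuple B D → B k
component                   here        (x , _) = x
component {D = inside  ∷ _} (there k∈D) (_ , t) = component k∈D t
component {D = outside ∷ _} (there k∈D) t       = component k∈D t

restrict : ∀ {B : Fin m → Set} {E D} → E ⊆ D → Tuple B D → Tuple B E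
restrict {E = []}          {D = []}          E⊆D t       = tt
restrict {E = outside ∷ _} {D = outside ∷ _} E⊆D t       = restrict (drop-∷-⊆ E⊆D) t
restrict {E = outside ∷ _} {D = inside  ∷ _} E⊆D (_ , t) = restrict (drop-∷-⊆ E⊆D) t
restrict {E = inside  ∷ _} {D = inside  ∷ _} E⊆D (x , t) = x , restrict (drop-∷-⊆ E⊆D) t
restrict {E = inside  ∷ _} {D = outside ∷ _} E⊆D t       with () ← E⊆D here

fullTuple : ∀ {X : Set} → Tuple {m} (λ _ → X) Full → Vec X m
fullTuple {m = zero}  tt      = []
fullTuple {m = suc _} (x , t) = x ∷ fullTuple t

record Partition (D E F : Subset m) : Set where
  field
    disjoint : Empty (E ∩ F)
    covers   : E ∪ F ≡ D

  left⊆ : E ⊆ D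
  left⊆ {k} k∈E = subst (k ∈_) covers (p⊆p∪q F k∈E)

  right⊆ : F ⊆ D
  right⊆ {k} k∈F = subst (k ∈_) covers (q⊆p∪q E F k∈F)

  left< : Nonempty F → ∣ E ∣ < ∣ D ∣
  left< (k , k∈F) =
    p⊂q⇒∣p∣<∣q∣ (left⊆ , k , right⊆ k∈F , λ k∈E → disjoint (k , x∈p∩q⁺ (k∈E , k∈F)))

  right< : Nonempty E → ∣ F ∣ < ∣ D ∣
  right< (k , k∈E) =
    p⊂q⇒∣p∣<∣q∣ (right⊆ , k , left⊆ k∈E , λ k∈F → disjoint (k , x∈p∩q⁺ (k∈E , k∈F)))

open Partition

-- The index types of the blocks X̃⁽⁰⁾ , … , X̃⁽ᵈ⁾: block k is indexed by (j_k , i_{k+1}),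
-- where j_0 is absent (L = ⊤ for the outermost call) and so is i_{d+1}.
BlocksFrom : Set → ℕ → (d : ℕ) → Fin (suc d) → Set
BlocksFrom L n zero    zero    = L
BlocksFrom L n (suc d) zero    = L × Fin n
BlocksFrom L n (suc d) (suc k) = BlocksFrom (Fin n) n d k

Blocks : ℕ → (d : ℕ) → Fin (suc d) → Set
Blocks = BlocksFrom ⊤

rowColumnFrom : ∀ {L n} d → Tuple (BlocksFrom L n d) Full → L × Vec (Fin n) d × Vec (Fin n) d
rowColumnFrom zero    (l , tt)      = l , [] , []
rowColumnFrom (suc d) ((l , i) , x) =
  let j , is , js = rowColumnFrom d x in l , i ∷ is , j ∷ js

rowColumn : ∀ {n d} → Tuple (Blocks n d) Full → Vec (Fin n) d × Vec (Fin n) d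
rowColumn {d = d} x = proj₂ (rowColumnFrom d x)

-- Classically a Heyting field is exactly a field: its apartness x # y is then ¬ x ≈ y.
module OverField {c ℓ₁ ℓ₂} (𝔽 : HeytingField c ℓ₁ ℓ₂) where

  open HeytingField 𝔽 using (Carrier; _≈_; _+_; _*_; 0#; 1#; heytingCommutativeRing)
  open CommutativeRing (HeytingCommutativeRing.commutativeRing heytingCommutativeRing)
    using (+-rawMonoid)

  sum : ∀ {t} → (Fin t → Carrier) → Carrier
  sum = RawMonoidSum.sum +-rawMonoid

  LinearlyIndependent : ∀ {X : Set} {s} → (Fin s → X → Carrier) → Set (c ⊔ ℓ₁)
  LinearlyIndependent {X} {s} v =
    ∀ (α : Fin s → Carrier) → (∀ x → sum (λ k → α k * v k x) ≈ 0#) → ∀ k → α k ≈ 0#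

  -- Rank as the maximal number of linearly independent columns.
  HasRank : ∀ {R C : Set} → (R → C → Carrier) → ℕ → Set (c ⊔ ℓ₁)
  HasRank {C = C} M r =
    (Σ[ cols ∈ (Fin r → C) ] Independent cols) ×
    (∀ s (cols : Fin s → C) → Independent cols → s ≤ r)
    where
    Independent : ∀ {s} → (Fin s → C) → Set (c ⊔ ℓ₁)
    Independent cols = LinearlyIndependent (λ k i → M i (cols k))

  Matrix : ℕ → ℕ → Set c
  Matrix n d = Vec (Fin n) d → Vec (Fin n) d → Carrier

  partialTranspose : ∀ {n d} → Fin d → Matrix n d → Matrix n d
  partialTranspose k M i j = M (i [ k ]≔ lookup j k) (j [ k ]≔ lookup i k)

  _^⊤_ : ∀ {n d} → Matrix n d → Subset d → Matrix n d
  M ^⊤ κ = foldr (λ k N → if lookup κ k then partialTranspose k N else N) M (allFin _)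

  PTBasic : ∀ {n d} → Matrix n d → Set (c ⊔ ℓ₁)
  PTBasic M = ∃[ κ ] HasRank (M ^⊤ κ) 1

  IsPTRank : ∀ {n d} → Matrix n d → ℕ → Set (c ⊔ ℓ₁)
  IsPTRank {n} {d} M = IsMinimum λ r →
    Σ[ N ∈ (Fin r → Matrix n d) ]
      (∀ k → PTBasic (N k)) × (∀ i j → M i j ≈ sum (λ k → N k i j))

  Tensor : (Fin m → Set) → Subset m → Set c
  Tensor B D = Tuple B D → Carrier

  IsZero : ∀ (B : Fin m → Set) D → Tensor B D → Set ℓ₁
  IsZero B D A = ∀ (x : Tuple B D) → A x ≈ 0#

  tensorProduct : ∀ {B : Fin m → Set} {D E F} → Partition D E F →
                  Tensor B E → Tensor B F → Tensor B D
  tensorProduct P S T x = S (restrict (left⊆ P) x) * T (restrict (right⊆ P) x)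

  record Decomposition (B : Fin m → Set) (D : Subset m) (A : Tensor B D) : Set (c ⊔ ℓ₁) where
    field
      terms          : ℕ
      E F            : Fin terms → Subset m
      E-nonempty     : ∀ i → Nonempty (E i)
      F-nonempty     : ∀ i → Nonempty (F i)
      partition      : ∀ i → Partition D (E i) (F i)
      S              : ∀ i → Tensor B (E i)
      T              : ∀ i → Tensor B (F i)
      sumsToA        : ∀ x → A x ≈ sum (λ i → tensorProduct (partition i) (S i) (T i) x)

  open Decomposition

  -- The graph of 𝓛_sm; the accessibility argument only drives the recursion on ∣ D ∣.
  IsLsmAcc : ∀ (B : Fin m → Set) D → Acc _<_ ∣ D ∣ → Tensor B D → ℕ → Set (c ⊔ ℓ₁)
  IsLsmAcc B D (acc rec) A l =
      (∣ D ∣ ≡ 1 × ¬ IsZero B D A × l ≡ 1)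
    ⊎ (∣ D ∣ ≡ 1 × IsZero B D A × l ≡ 0)
    ⊎ (2 ≤ ∣ D ∣ × IsMinimum Cost l)
    where
    Cost : ℕ → Set (c ⊔ ℓ₁)
    Cost s =
      Σ[ 𝒟 ∈ Decomposition B D A ]
      Σ[ b ∈ (Fin (terms 𝒟) → ℕ) ] Σ[ b′ ∈ (Fin (terms 𝒟) → ℕ) ]
        (∀ i → IsLsmAcc B (E 𝒟 i) (rec (left<  (partition 𝒟 i) (F-nonempty 𝒟 i))) (S 𝒟 i) (b  i)) ×
        (∀ i → IsLsmAcc B (F 𝒟 i) (rec (right< (partition 𝒟 i) (E-nonempty 𝒟 i))) (T 𝒟 i) (b′ i)) ×
        s ≡ sumℕ (λ i → b i ℕ.+ b′ i)

  IsLsm : ∀ (B : Fin m → Set) D → Tensor B D → ℕ → Set (c ⊔ ℓ₁)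
  IsLsm B D = IsLsmAcc B D (<-wellFounded ∣ D ∣)

  -- The argument, read through [n²] ≅ [n]², is the list of pairs
  -- (p , i₁) , (j₁ , i₂) , … , (j_d , q).  Indices are 0-based, so p = q = 1 becomes 0,
  -- and ⟨ i , j ⟩ = i n + j is inverted by remQuot.
  ShiftedTensor : ∀ {n d} → Matrix n d → Tensor {suc d} (λ _ → Fin (n ℕ.* n)) Full
  ShiftedTensor {n} {d} M x =
    if ⌊ toℕ (head firsts) ≟ 0 ⌋
    then (if ⌊ toℕ (last seconds) ≟ 0 ⌋ then M (init seconds) (tail firsts) else 0#)
    else 0#
    where
    pairs : Vec (Fin n × Fin n) (suc d)
    pairs = Vec.map (remQuot n) (fullTuple x)

    firsts seconds : Vec (Fin n) (suc d)
    firsts  = Vec.map proj₁ pairs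
    seconds = Vec.map proj₂ pairs

  -- Syntactically set-multilinear formulas over blocks of variables X⁽ᵏ⁾_b (b : B k),
  -- indexed by the set of blocks occurring.  Leaves are scalars or linear forms in the
  -- variables of one block (single variables being a special case), sums have arbitrary
  -- finite fan-in.
  data Formula (B : Fin m → Set) : Subset m → Set c where
    scalar  : Carrier → Formula B ∅
    linear  : ∀ k → (B k → Carrier) → Formula B ⁅ k ⁆
    add     : ∀ {D} t → (Fin t → Formula B D) → Formula B D
    mul     : ∀ {D E F} → Partition D E F → Formula B E → Formula B F → Formula B D

  leaves : ∀ {B : Fin m → Set} {D} → Formula B D → ℕ
  leaves (scalar _)   = 1
  leaves (linear _ _) = 1
  leaves (add _ φ)    = sumℕ (λ i → leaves (φ i))
  leaves (mul _ φ ψ)  = leaves φ ℕ.+ leaves ψ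

  -- A set-multilinear polynomial Σₐ A(a) Π_{k ∈ D} X⁽ᵏ⁾_{aₖ} is represented by its
  -- coefficient tensor A; coefficients φ is that of the polynomial computed by φ.
  coefficients : ∀ {B : Fin m → Set} {D} → Formula B D → Tensor B D
  coefficients (scalar α)   _ = α
  coefficients (linear k v) x = v (component (x∈⁅x⁆ k) x)
  coefficients (add _ φ)    x = sum (λ i → coefficients (φ i) x)
  coefficients (mul P φ ψ)    = tensorProduct P (coefficients φ) (coefficients ψ)

  Computes : ∀ {B : Fin m → Set} {D} → Formula B D → Tensor B D → Set ℓ₁
  Computes {B = B} {D} φ A = ∀ (x : Tuple B D) → coefficients φ x ≈ A x

  -- The coefficient tensor of Q̃_M.
  Q̃ : ∀ {n d} → Matrix n d → Tensor (Blocks n d) Full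
  Q̃ M x = M (proj₁ (rowColumn x)) (proj₂ (rowColumn x))

{-# OPTIONS --safe #-}
module Submission where

-- Always expanding the factor with more blocks, one writes the tensor as a sum of l
-- products of tensors over K parts of the path of blocks 0 , … , d, with 2(d+1) ≤ 2^K.
-- Walking along the path and giving each newly met part the colour opposite to the
-- preceding block yields a 2-colouring of the parts with at least K − 1 bichromatic edges.
-- Edge k joins the blocks containing i_k and j_k.  After the partial transposition that
-- moves the index at the first-coloured end of each bichromatic edge to the rows, a product
-- becomes a row function times a column function, up to the at most d + 1 − K
-- monochromatic edges; fixing one index of each of these costs a factor n per edge.
-- Hence PT-rank(M) ≤ l n^(d+1−K).

open import Defs
open import Algebra.Apartness.Bundles using (HeytingField; HeytingCommutativeRing)
import Algebra.Apartness.Properties.HeytingCommutativeRing as HeytingProperties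
open import Algebra.Bundles using (CommutativeRing)
import Algebra.Properties.CommutativeSemigroup as CommutativeSemigroupProperties
import Algebra.Properties.Monoid.Sum as MonoidSum
import Algebra.Properties.Ring as RingProperties
open import Data.Bool.Base using (Bool; true; false; not; _∧_; if_then_else_)
open import Data.Bool.Properties using (∧-zeroʳ)
open import Data.Empty using (⊥-elim)
open import Data.Fin.Base using (Fin; zero; suc; toℕ; inject₁; combine; remQuot)
open import Data.Fin.Properties as Finₚ using (injective⇒≤; toℕ-injective; toℕ<n; remQuot-combine)
open import Data.Fin.Subset
  using (Subset; inside; outside; _∈_; _⊆_; _∪_; ∣_∣; ⁅_⁆; Nonempty) renaming (⊤ to Full; ⊥ to ∅)
open import Data.Fin.Subset.Properties
  using (_∈?_; nonempty?; Empty-unique; ∣⊥∣≡0; ∣⊤∣≡n; ∣⁅x⁆∣≡1; ∪-comm; ∩-comm; x∈p∩q⁺; drop-∷-⊆)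
open import Data.List.Base as List using (List; []; _∷_; allFin)
open import Data.List.Membership.DecPropositional using () renaming (_∈?_ to mem?)
open import Data.List.Membership.Propositional using () renaming (_∈_ to _∈ˡ_; _∉_ to _∉ˡ_)
open import Data.List.Membership.Propositional.Properties using (∈-allFin)
open import Data.List.Relation.Unary.All as All using ()
open import Data.List.Relation.Unary.AllPairs using (_∷_)
open import Data.List.Relation.Unary.Any as Any using (here; there)
open import Data.List.Relation.Unary.Any.Properties using (lookup-index)
open import Data.List.Relation.Unary.Unique.Propositional using (Unique)
open import Data.List.Relation.Unary.Unique.Propositional.Properties using (allFin⁺)
open import Data.Nat.Base as ℕ using (ℕ; zero; suc; NonZero; z≤n; s≤s)
open import Data.Nat.Induction using (<-wellFounded)
import Data.Nat.ListAction as ListAction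
import Data.Nat.Properties as ℕₚ
open import Data.Product.Base using (Σ-syntax; ∃-syntax; _×_; _,_; proj₁; proj₂; uncurry; map₂)
open import Data.Sum.Base using (inj₁; inj₂)
open import Data.Unit.Base using (tt)
open import Data.Vec.Base as Vec
  using (Vec; []; _∷_; lookup; _[_]≔_; _∷ʳ_; init; last; tail; head; here; there)
open import Data.Vec.Properties
  using (lookup-map; []≔-lookup; lookup∘tabulate; lookup∘update; lookup∘update′; init-∷ʳ; last-∷ʳ)
open import Data.Vec.Relation.Binary.Pointwise.Extensional using (ext; Pointwise-≡⇒≡)
open import Function.Base using (_∘_; id; case_of_)
open import Induction.WellFounded using (acc)
open import Level using (Level; _⊔_)
open import Relation.Binary.PropositionalEquality as ≡ using (_≡_; _≢_; cong; cong₂; subst)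
import Relation.Binary.Reasoning.Setoid as SetoidReasoning
open import Relation.Nullary.Decidable using (yes; no; decidable-stable; ¬¬-excluded-middle; ⌊_⌋)
open import Relation.Nullary.Negation using (¬_; contradiction; ¬¬-map)

private
  variable
    p p′ : Level
    m n d : ℕ

-- Natural-number sums, powers, and the exponent d - log₂ d + 1.

sumℕ-const : ∀ t s → sumℕ {t} (λ _ → s) ≡ t ℕ.* s
sumℕ-const zero    s = ≡.refl
sumℕ-const (suc t) s = cong (s ℕ.+_) (sumℕ-const t s)

sum-map-tabulate : ∀ {t} {X : Set} (g : X → ℕ) (f : Fin t → X) →
                   ListAction.sum (List.map g (List.tabulate f)) ≡ sumℕ (g ∘ f)
sum-map-tabulate {zero}  g f = ≡.refl
sum-map-tabulate {suc t} g f = cong (g (f zero) ℕ.+_) (sum-map-tabulate g (f ∘ suc))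

^-distribʳ-* : ∀ o x y → (x ℕ.* y) ℕ.^ o ≡ x ℕ.^ o ℕ.* y ℕ.^ o
^-distribʳ-* zero    x y = ≡.refl
^-distribʳ-* (suc o) x y = ≡.trans (cong (x ℕ.* y ℕ.*_) (^-distribʳ-* o x y))
  (CommutativeSemigroupProperties.interchange ℕₚ.*-commutativeSemigroup x y (x ℕ.^ o) (y ℕ.^ o))

n<2^n : ∀ x → x ℕ.< 2 ℕ.^ x
n<2^n zero    = ℕₚ.≤-refl
n<2^n (suc x) = ℕₚ.≤-trans (ℕₚ.+-mono-≤ (ℕₚ.m^n>0 2 x) (n<2^n x))
  (ℕₚ.≤-reflexive (cong (2 ℕ.^ x ℕ.+_) (≡.sym (ℕₚ.+-identityʳ _))))

-- For N ≥ 1 this K is ⌈log₂ N⌉. Minimality will place it below the number of parts of every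
-- factored term.
least-power : ∀ N → ∃[ K ] N ℕ.≤ 2 ℕ.^ K × (∀ K′ → N ℕ.≤ 2 ℕ.^ K′ → K ℕ.≤ K′)
least-power zero = 0 , z≤n , λ _ _ → z≤n
least-power (suc N) with least-power N
... | K , N≤2^K , least with suc N ℕₚ.≤? 2 ℕ.^ K
...   | yes N<2^K = K , N<2^K , λ K′ N<2^K′ → least K′ (ℕₚ.<⇒≤ N<2^K′)
...   | no  N≮2^K = suc K , suc-≤ , λ K′ N<2^K′ → ℕₚ.≰⇒> λ K′≤K →
        N≮2^K (ℕₚ.≤-trans N<2^K′ (ℕₚ.^-monoʳ-≤ 2 K′≤K))
  where
  open ℕₚ.≤-Reasoning
  suc-≤ : suc N ℕ.≤ 2 ℕ.^ suc K
  suc-≤ = begin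
    1 ℕ.+ N                   ≤⟨ ℕₚ.+-mono-≤ (ℕₚ.m^n>0 2 K) N≤2^K ⟩
    2 ℕ.^ K ℕ.+ 2 ℕ.^ K       ≡⟨ cong (2 ℕ.^ K ℕ.+_) (ℕₚ.+-identityʳ _) ⟨
    2 ℕ.^ suc K               ∎

-- From d ≤ 2^K follows log₂ d ≤ K, so d + 1 - K is at most d - log₂ d + 1. For a rational p/q below
-- log₂ d this reads p ≤ K q, and then q-th powers are compared.
clear-root : ∀ {r l n d K} .{{_ : NonZero n}} → K ℕ.≤ suc d → d ℕ.≤ 2 ℕ.^ K →
             r ℕ.≤ l ℕ.* n ℕ.^ (suc d ℕ.∸ K) → r / n ^[ d -log₂ d +1]≤ l
clear-root {r} {l} {n} {d} {K} K≤1+d d≤2^K r≤ p q 2^p≤d^q = begin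
  r ℕ.^ q ℕ.* n ℕ.^ p
    ≤⟨ ℕₚ.*-mono-≤ (ℕₚ.^-monoˡ-≤ q r≤) (ℕₚ.^-monoʳ-≤ n p≤Kq) ⟩
  (l ℕ.* n ℕ.^ e) ℕ.^ q ℕ.* n ℕ.^ (K ℕ.* q)
    ≡⟨ cong ((l ℕ.* n ℕ.^ e) ℕ.^ q ℕ.*_) (ℕₚ.^-*-assoc n K q) ⟨
  (l ℕ.* n ℕ.^ e) ℕ.^ q ℕ.* (n ℕ.^ K) ℕ.^ q
    ≡⟨ ^-distribʳ-* q (l ℕ.* n ℕ.^ e) (n ℕ.^ K) ⟨
  (l ℕ.* n ℕ.^ e ℕ.* n ℕ.^ K) ℕ.^ q
    ≡⟨ cong (ℕ._^ q) (ℕₚ.*-assoc l _ _) ⟩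
  (l ℕ.* (n ℕ.^ e ℕ.* n ℕ.^ K)) ℕ.^ q
    ≡⟨ cong (λ x → (l ℕ.* x) ℕ.^ q) (ℕₚ.^-distribˡ-+-* n e K) ⟨
  (l ℕ.* n ℕ.^ (e ℕ.+ K)) ℕ.^ q
    ≡⟨ cong (λ x → (l ℕ.* n ℕ.^ x) ℕ.^ q) (≡.trans (ℕₚ.m∸n+n≡m K≤1+d) (ℕₚ.+-comm 1 d)) ⟩
  (l ℕ.* n ℕ.^ (d ℕ.+ 1)) ℕ.^ q
    ∎
  where
  open ℕₚ.≤-Reasoning
  e : ℕ
  e = suc d ℕ.∸ K

  p≤Kq : p ℕ.≤ K ℕ.* q
  p≤Kq = ℕₚ.≮⇒≥ λ Kq<p → ℕₚ.<⇒≱ (ℕₚ.^-monoʳ-< 2 ℕₚ.≤-refl Kq<p) (begin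
    2 ℕ.^ p            ≤⟨ 2^p≤d^q ⟩
    d ℕ.^ q            ≤⟨ ℕₚ.^-monoˡ-≤ q d≤2^K ⟩
    (2 ℕ.^ K) ℕ.^ q    ≡⟨ ℕₚ.^-*-assoc 2 K q ⟩
    2 ℕ.^ (K ℕ.* q)    ∎)

-- Colourings of the path 0 , 1 , … , d

agree : Bool → Bool → ℕ
agree true  true  = 1
agree true  false = 0
agree false true  = 0
agree false false = 1

agree≤1 : ∀ x y → agree x y ℕ.≤ 1
agree≤1 true  true  = ℕₚ.≤-refl
agree≤1 true  false = z≤n
agree≤1 false true  = z≤n
agree≤1 false false = ℕₚ.≤-refl

agree-not : ∀ x → agree (not x) x ≡ 0
agree-not true  = ≡.refl
agree-not false = ≡.refl

monochromatic : (Fin (suc d) → Bool) → ℕ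
monochromatic c = sumℕ λ e → agree (c (inject₁ e)) (c (suc e))

-- Reading the path from its far end, each new label is coloured differently from its neighbour.
greedy-colouring : ∀ d (label : Fin (suc d) → ℕ) →
  Σ[ L ∈ List ℕ ] Σ[ χ ∈ (ℕ → Bool) ]
    (∀ k → label k ∈ˡ L) × monochromatic (χ ∘ label) ℕ.+ List.length L ℕ.≤ suc d
greedy-colouring zero label =
  label zero ∷ [] , (λ _ → true) , (λ { zero → here ≡.refl }) , ℕₚ.≤-refl
greedy-colouring (suc d) label with greedy-colouring d (label ∘ suc)
... | L , χ , labels∈L , bound with mem? ℕₚ._≟_ (label zero) L
...   | yes ∈L = L , χ , (λ { zero → ∈L ; (suc k) → labels∈L k }) ,
        ℕₚ.≤-trans (ℕₚ.≤-reflexive (ℕₚ.+-assoc (agree (χ (label zero)) (χ (label (suc zero)))) _ _))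
                   (ℕₚ.+-mono-≤ (agree≤1 (χ (label zero)) _) bound)
-- A label outside L occurs nowhere further along the path, so recolouring it disturbs no other
-- edge. The new edge becomes bichromatic, and L grows by one together with the number of blocks.
...   | no  ∉L = label zero ∷ L , χ′ ,
        (λ { zero → here ≡.refl ; (suc k) → there (labels∈L k) }) , (begin
          agree (χ′ (label zero)) (χ′ (label (suc zero)))
            ℕ.+ monochromatic (χ′ ∘ label ∘ suc) ℕ.+ suc (List.length L)
            ≡⟨ cong₂ (λ x y → x ℕ.+ y ℕ.+ suc (List.length L))
                 (≡.trans (cong₂ agree χ′-new (χ′-old zero)) (agree-not _))
                 (MonoidSum.sum-cong-≗ ℕₚ.+-0-monoid λ e → cong₂ agree (χ′-old (inject₁ e)) (χ′-old (suc e))) ⟩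
          monochromatic (χ ∘ label ∘ suc) ℕ.+ suc (List.length L)
            ≡⟨ ℕₚ.+-suc _ _ ⟩
          suc (monochromatic (χ ∘ label ∘ suc) ℕ.+ List.length L)
            ≤⟨ s≤s bound ⟩
          suc (suc d) ∎)
  where
  open ℕₚ.≤-Reasoning
  χ′ : ℕ → Bool
  χ′ x with x ℕₚ.≟ label zero
  ... | yes _ = not (χ (label (suc zero)))
  ... | no  _ = χ x

  χ′-new : χ′ (label zero) ≡ not (χ (label (suc zero)))
  χ′-new with label zero ℕₚ.≟ label zero
  ... | yes _ = ≡.refl
  ... | no  ≢ = contradiction ≡.refl ≢

  χ′-old : ∀ k → χ′ (label (suc k)) ≡ χ (label (suc k))
  χ′-old k with label (suc k) ℕₚ.≟ label zero
  ... | yes ≡₀ = contradiction (subst (_∈ˡ L) ≡₀ (labels∈L k)) ∉L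
  ... | no  _  = ≡.refl

-- Pigeonhole: an entry is recovered from its position, so positions in L embed the numbers below K.
initial-segment≤length : ∀ {K} (L : List ℕ) → (∀ a → a ℕ.< K → a ∈ˡ L) → K ℕ.≤ List.length L
initial-segment≤length {K} L a∈L = injective⇒≤ {f = position} position-injective
  where
  position : Fin K → Fin (List.length L)
  position i = Any.index (a∈L (toℕ i) (toℕ<n i))

  position-injective : ∀ {i j} → position i ≡ position j → i ≡ j
  position-injective {i} {j} eq = toℕ-injective
    (≡.trans (lookup-index (a∈L (toℕ i) (toℕ<n i)))
             (≡.trans (cong (List.lookup L) eq) (≡.sym (lookup-index (a∈L (toℕ j) (toℕ<n j))))))

few-monochromatic : ∀ {K} (label : Fin (suc d) → ℕ) → (∀ a → a ℕ.< K → ∃[ k ] label k ≡ a) →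
                    Σ[ χ ∈ (ℕ → Bool) ] monochromatic (χ ∘ label) ℕ.+ K ℕ.≤ suc d
few-monochromatic {d} label onto with greedy-colouring d label
... | L , χ , labels∈L , bound =
  χ , ℕₚ.≤-trans (ℕₚ.+-monoʳ-≤ _ (initial-segment≤length L λ a a<K →
        case onto a a<K of λ { (k , eq) → subst (_∈ˡ L) eq (labels∈L k) })) bound

-- Partial transposition as a permutation of index pairs

module _ {A : Set} where

  vec-ext : {i j : Vec A d} → (∀ e → lookup i e ≡ lookup j e) → i ≡ j
  vec-ext eq = Pointwise-≡⇒≡ (ext eq)

  -- Closed form of `_^⊤_` on indices: at (i , j) the transposed matrix reads the entry at
  -- (`mix κ i j` , `mix κ j i`).
  mix : Subset d → Vec A d → Vec A d → Vec A d
  mix κ i j = Vec.tabulate λ e → if lookup κ e then lookup j e else lookup i e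

  lookup-mix : ∀ (κ : Subset d) i j e →
               lookup (mix κ i j) e ≡ (if lookup κ e then lookup j e else lookup i e)
  lookup-mix κ i j e = lookup∘tabulate _ e

  mix-involutive : ∀ (κ : Subset d) i j → mix κ (mix κ i j) (mix κ j i) ≡ i
  mix-involutive κ i j = vec-ext λ e → ≡.trans (lookup-mix κ (mix κ i j) (mix κ j i) e) (pointwise e)
    where
    pointwise : ∀ e → (if lookup κ e then lookup (mix κ j i) e else lookup (mix κ i j) e) ≡ lookup i e
    pointwise e rewrite lookup-mix κ i j e | lookup-mix κ j i e with lookup κ e
    ... | true  = ≡.refl
    ... | false = ≡.refl

  lookup-mix-false : ∀ (κ : Subset d) {i j e} → lookup κ e ≡ false → lookup (mix κ i j) e ≡ lookup i e
  lookup-mix-false κ {i} {j} {e} κe = ≡.trans (lookup-mix κ i j e) (cong (if_then lookup j e else lookup i e) κe)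

  lookup-mix-true : ∀ (κ : Subset d) {i j e} → lookup κ e ≡ true → lookup (mix κ i j) e ≡ lookup j e
  lookup-mix-true κ {i} {j} {e} κe = ≡.trans (lookup-mix κ i j e) (cong (if_then lookup j e else lookup i e) κe)

  -- In the recursion of `rank-one-terms`, l holds the positions still to be treated, and Q marks
  -- those through which the unwanted dependence enters.
  AgreeOn : (Fin d → Set) → List (Fin d) → Vec A d → Vec A d → Set
  AgreeOn Q l i j = ∀ e → e ∈ˡ l → Q e → lookup i e ≡ lookup j e

  agreeOn-∷ : ∀ {Q : Fin d → Set} {l} i j {e} → ¬ Q e → AgreeOn Q l i j → AgreeOn Q (e ∷ l) i j
  agreeOn-∷ i j ¬Qe eq _ (here ≡.refl) Qe = contradiction Qe ¬Qe
  agreeOn-∷ i j ¬Qe eq f (there f∈l)   Qf = eq f f∈l Qf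

  agreeOn-update : ∀ {Q : Fin d → Set} {l} i j {e v} →
                   AgreeOn Q l i j → AgreeOn Q (e ∷ l) (i [ e ]≔ v) (j [ e ]≔ v)
  agreeOn-update i j {e} {v} eq f f∈ Qf with f Finₚ.≟ e | f∈
  ... | yes ≡.refl | _          = ≡.trans (lookup∘update e i v) (≡.sym (lookup∘update e j v))
  ... | no  f≢e    | here f≡e   = contradiction f≡e f≢e
  ... | no  f≢e    | there f∈l  = ≡.trans (lookup∘update′ f≢e i v)
                                    (≡.trans (eq f f∈l Qf) (≡.sym (lookup∘update′ f≢e j v)))

  -- Follows the row index through the fold in `_^⊤_`: the transposition at the head of the list
  -- acts first on the indices.
  swaps : Subset d → List (Fin d) → Vec A d → Vec A d → Vec A d
  swaps κ []      i j = i
  swaps κ (k ∷ l) i j =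
    if lookup κ k then swaps κ l (i [ k ]≔ lookup j k) (j [ k ]≔ lookup i k) else swaps κ l i j

  lookup-swaps-∉ : ∀ (κ : Subset d) l i j {e} → e ∉ˡ l → lookup (swaps κ l i j) e ≡ lookup i e
  lookup-swaps-∉ κ []      i j e∉ = ≡.refl
  lookup-swaps-∉ κ (k ∷ l) i j e∉ with lookup κ k
  ... | true  = ≡.trans (lookup-swaps-∉ κ l _ _ (e∉ ∘ there))
                        (lookup∘update′ (e∉ ∘ here) i _)
  ... | false = lookup-swaps-∉ κ l i j (e∉ ∘ there)

  -- Uniqueness matters because two swaps at the same coordinate would cancel.
  lookup-swaps-∈ : ∀ (κ : Subset d) {l} i j {e} → Unique l → e ∈ˡ l →
                   lookup (swaps κ l i j) e ≡ (if lookup κ e then lookup j e else lookup i e)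
  lookup-swaps-∈ κ {k ∷ l} i j (k≢ ∷ _) (here ≡.refl) with lookup κ k
  ... | true  = ≡.trans (lookup-swaps-∉ κ l _ _ (λ k∈l → All.lookup k≢ k∈l ≡.refl))
                        (lookup∘update k i _)
  ... | false = lookup-swaps-∉ κ l i j (λ k∈l → All.lookup k≢ k∈l ≡.refl)
  lookup-swaps-∈ κ {k ∷ l} i j {e} (k≢ ∷ unique) (there e∈l) with lookup κ k
  ... | false = lookup-swaps-∈ κ i j unique e∈l
  ... | true  = ≡.trans (lookup-swaps-∈ κ _ _ unique e∈l)
                  (cong₂ (if lookup κ e then_else_) (lookup∘update′ e≢k j _) (lookup∘update′ e≢k i _))
    where
    e≢k : e ≢ k
    e≢k e≡k = All.lookup k≢ e∈l (≡.sym e≡k)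

  swaps-allFin : ∀ (κ : Subset d) i j → swaps κ (allFin d) i j ≡ mix κ i j
  swaps-allFin {d} κ i j = vec-ext λ e →
    ≡.trans (lookup-swaps-∈ κ i j (allFin⁺ d) (∈-allFin e)) (≡.sym (lookup-mix κ i j e))

-- Points and tuples

-- A point has a coordinate in every block, so tensors over different sets of blocks become
-- functions on one domain and multiply pointwise.
Point : (Fin m → Set) → Set
Point B = ∀ k → B k

tuple : ∀ {B : Fin m → Set} D → Point B → Tuple B D
tuple []            x = tt
tuple (inside  ∷ D) x = x zero , tuple D (λ k → x (suc k))
tuple (outside ∷ D) x = tuple D (λ k → x (suc k))

tuple-cong : ∀ {B : Fin m → Set} D {x y : Point B} → (∀ k → k ∈ D → x k ≡ y k) → tuple D x ≡ tuple D y
tuple-cong []            eq = ≡.refl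
tuple-cong (inside  ∷ D) eq = cong₂ _,_ (eq zero here) (tuple-cong D λ k k∈D → eq (suc k) (there k∈D))
tuple-cong (outside ∷ D) eq = tuple-cong D λ k k∈D → eq (suc k) (there k∈D)

restrict-tuple : ∀ {B : Fin m → Set} {E D} (E⊆D : E ⊆ D) (x : Point B) →
                 restrict E⊆D (tuple D x) ≡ tuple E x
restrict-tuple {E = []}          {D = []}          E⊆D x = ≡.refl
restrict-tuple {E = outside ∷ _} {D = outside ∷ _} E⊆D x = restrict-tuple (drop-∷-⊆ E⊆D) _
restrict-tuple {E = outside ∷ _} {D = inside  ∷ _} E⊆D x = restrict-tuple (drop-∷-⊆ E⊆D) _
restrict-tuple {E = inside  ∷ _} {D = inside  ∷ _} E⊆D x = cong (x zero ,_) (restrict-tuple (drop-∷-⊆ E⊆D) _)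
restrict-tuple {E = inside  ∷ _} {D = outside ∷ _} E⊆D x with () ← E⊆D here

∣p∪q∣≤∣p∣+∣q∣ : ∀ (p q : Subset m) → ∣ p ∪ q ∣ ℕ.≤ ∣ p ∣ ℕ.+ ∣ q ∣
∣p∪q∣≤∣p∣+∣q∣ []            []            = z≤n
∣p∪q∣≤∣p∣+∣q∣ (inside  ∷ p) (inside  ∷ q) =
  s≤s (ℕₚ.≤-trans (∣p∪q∣≤∣p∣+∣q∣ p q) (ℕₚ.+-monoʳ-≤ ∣ p ∣ (ℕₚ.n≤1+n _)))
∣p∪q∣≤∣p∣+∣q∣ (inside  ∷ p) (outside ∷ q) = s≤s (∣p∪q∣≤∣p∣+∣q∣ p q)
∣p∪q∣≤∣p∣+∣q∣ (outside ∷ p) (inside  ∷ q) =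
  ℕₚ.≤-trans (s≤s (∣p∪q∣≤∣p∣+∣q∣ p q)) (ℕₚ.≤-reflexive (≡.sym (ℕₚ.+-suc ∣ p ∣ ∣ q ∣)))
∣p∪q∣≤∣p∣+∣q∣ (outside ∷ p) (outside ∷ q) = ∣p∪q∣≤∣p∣+∣q∣ p q

∣p∣≢0⇒nonempty : ∀ (p : Subset m) → 1 ℕ.≤ ∣ p ∣ → Nonempty p
∣p∣≢0⇒nonempty {m} p 1≤∣p∣ with nonempty? p
... | yes ne = ne
... | no  em = contradiction 1≤∣p∣ (ℕₚ.n≮0 ∘ subst (1 ℕ.≤_) (≡.trans (cong ∣_∣ (Empty-unique em)) (∣⊥∣≡0 m)))

partition-sym : ∀ {D E F : Subset m} → Partition D E F → Partition D F E
partition-sym {E = E} {F} P = record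
  { disjoint = λ { (k , k∈) → Partition.disjoint P (k , subst (k ∈_) (∩-comm F E) k∈) }
  ; covers   = ≡.trans (∪-comm F E) (Partition.covers P)
  }

module LowerBound {c ℓ₁ ℓ₂} (𝔽 : HeytingField c ℓ₁ ℓ₂) where

  open OverField 𝔽
  open HeytingField 𝔽 using (_#_; tight; #⇒invertible; heytingCommutativeRing)
  open CommutativeRing (HeytingCommutativeRing.commutativeRing heytingCommutativeRing) hiding (zero)
  open HeytingProperties heytingCommutativeRing using (x-0≈x; 1#0)
  open RingProperties ring using (-‿distribˡ-*)
  open CommutativeSemigroupProperties *-commutativeSemigroup using (x∙yz≈y∙xz)
  open SetoidReasoning setoid

  -- Sums over the field and decompositions with a bounded number of terms.

  sum-zero : ∀ {t} {f : Fin t → Carrier} → (∀ k → f k ≈ 0#) → sum f ≈ 0#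
  sum-zero {zero}  f≈0 = refl
  sum-zero {suc t} f≈0 = trans (+-cong (f≈0 zero) (sum-zero (f≈0 ∘ suc))) (+-identityˡ 0#)

  δ : Fin n → Fin n → Carrier
  δ zero    zero    = 1#
  δ zero    (suc v) = 0#
  δ (suc u) zero    = 0#
  δ (suc u) (suc v) = δ u v

  sum-δ : ∀ (u : Fin n) (w : Fin n → Carrier) → sum (λ v → δ u v * w v) ≈ w u
  sum-δ {suc n} zero w = trans (+-cong (*-identityˡ _) (sum-zero {n} λ v → zeroˡ (w (suc v)))) (+-identityʳ _)
  sum-δ (suc u) w = trans (+-cong (zeroˡ _) (sum-δ u (w ∘ suc))) (+-identityˡ _)

  -- The index s is only an upper bound on the number of terms.
  data SumOf {X : Set} (P : (X → Carrier) → Set p) : (X → Carrier) → ℕ → Set (p ⊔ c ⊔ ℓ₁) where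
    []   : ∀ {f s} → (∀ x → f x ≈ 0#) → SumOf P f s
    cons : ∀ {f g h s} → P g → SumOf P h s → (∀ x → f x ≈ g x + h x) → SumOf P f (suc s)

  module _ {X : Set} {P : (X → Carrier) → Set p} where

    respects : ∀ {f g s} → (∀ x → g x ≈ f x) → SumOf P f s → SumOf P g s
    respects g≈f ([] f≈0)         = [] λ x → trans (g≈f x) (f≈0 x)
    respects g≈f (cons Pg hs f≈+) = cons Pg hs λ x → trans (g≈f x) (f≈+ x)

    weaken : ∀ {f s t} → s ℕ.≤ t → SumOf P f s → SumOf P f t
    weaken s≤t       ([] f≈0)         = [] f≈0
    weaken (s≤s s≤t) (cons Pg hs f≈+) = cons Pg (weaken s≤t hs) f≈+

    singleton : ∀ {f} → P f → SumOf P f 1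
    singleton Pf = cons Pf ([] {f = λ _ → 0#} λ _ → refl) λ x → sym (+-identityʳ _)

    plus : ∀ {f g s t} → SumOf P f s → SumOf P g t → SumOf P (λ x → f x + g x) (s ℕ.+ t)
    -- An empty sum still carries its bound s, so the bound t must be raised.
    plus {s = s} {t} ([] f≈0) gs =
      weaken (ℕₚ.m≤n+m t s) (respects (λ x → trans (+-congʳ (f≈0 x)) (+-identityˡ _)) gs)
    plus (cons Ph hs f≈+) gs = cons Ph (plus hs gs) λ x → trans (+-congʳ (f≈+ x)) (+-assoc _ _ _)

    sum-of-sums : ∀ {t} {f : Fin t → X → Carrier} {s : Fin t → ℕ} →
                  (∀ i → SumOf P (f i) (s i)) → SumOf P (λ x → sum (λ i → f i x)) (sumℕ s)
    sum-of-sums {zero}  fs = [] λ _ → refl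
    sum-of-sums {suc t} fs = plus (fs zero) (sum-of-sums (fs ∘ suc))

  module _ {X Y : Set} {P : (X → Carrier) → Set p} {P′ : (Y → Carrier) → Set p′} where

    weighted-pullback : ∀ (k : Y → Carrier) (τ : Y → X) → (∀ g → P g → P′ (λ y → k y * g (τ y))) →
                        ∀ {f s} → SumOf P f s → SumOf P′ (λ y → k y * f (τ y)) s
    weighted-pullback k τ P→P′ ([] f≈0)         = [] λ y → trans (*-congˡ (f≈0 (τ y))) (zeroʳ _)
    weighted-pullback k τ P→P′ (cons Pg hs f≈+) =
      cons (P→P′ _ Pg) (weighted-pullback k τ P→P′ hs)
        λ y → trans (*-congˡ (f≈+ (τ y))) (distribˡ _ _ _)

    -- Each term may break into as many as n terms, whereas `weighted-pullback` turns one term into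
    -- one term.
    pullback : ∀ (τ : Y → X) → (∀ g → P g → SumOf P′ (g ∘ τ) n) →
               ∀ {f s} → SumOf P f s → SumOf P′ (f ∘ τ) (s ℕ.* n)
    pullback τ P→P′ ([] f≈0)         = [] (f≈0 ∘ τ)
    pullback τ P→P′ (cons Pg hs f≈+) =
      respects (f≈+ ∘ τ) (plus (P→P′ _ Pg) (pullback τ P→P′ hs))

  -- Products of many factors on disjoint sets of blocks

  module _ {m} {B : Fin m → Set} where

    extend : ∀ D → Tensor B D → Point B → Carrier
    extend D A x = A (tuple D x)

    DependsOn : (Fin m → Set) → (Point B → Carrier) → Set ℓ₁
    DependsOn Q f = ∀ x y → (∀ k → Q k → x k ≡ y k) → f x ≈ f y

    extend-dependsOn : ∀ D (A : Tensor B D) → DependsOn (_∈ D) (extend D A)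
    extend-dependsOn D A x y x≡y = reflexive (cong A (tuple-cong D x≡y))

    record Splits (D : Subset m) (colour : Fin m → Bool) (f : Point B → Carrier) : Set (c ⊔ ℓ₁) where
      field
        G H   : Point B → Carrier
        split : ∀ x → f x ≈ G x * H x
        G-on  : DependsOn (λ k → k ∈ D × colour k ≡ true) G
        H-on  : DependsOn (λ k → k ∈ D × colour k ≡ false) H

    -- A product of tensors over the nonempty parts of a partition of D: blocks with the
    -- same label form a part.  The factors themselves are not recorded; all that is used
    -- is that any 2-colouring of the parts groups them into two factors.
    record Factored (D : Subset m) (f : Point B → Carrier) : Set (c ⊔ ℓ₁) where
      field
        parts  : ℕ
        label  : Fin m → ℕ
        many   : 2 ℕ.* ∣ D ∣ ℕ.≤ 2 ℕ.^ parts
        onto   : ∀ a → a ℕ.< parts → ∃[ k ] k ∈ D × label k ≡ a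
        splits : ∀ (χ : ℕ → Bool) → Splits D (χ ∘ label) f

    -- The tensor is its own only factor. Taking ∣ D ∣ parts gives the empty set no part; for one
    -- block `many` reads 2 ≤ 2, whence the factor 2 in that field.
    factored-small : ∀ D (A : Tensor B D) → ∣ D ∣ ℕ.≤ 1 → Factored D (extend D A)
    factored-small D A ∣D∣≤1 = record
      { parts  = ∣ D ∣
      ; label  = λ _ → 0
      ; many   = many ∣D∣≤1
      ; onto   = λ a a<∣D∣ → case ∣p∣≢0⇒nonempty D (ℕₚ.≤-trans (s≤s z≤n) a<∣D∣) of λ
          { (k , k∈D) → k , k∈D , ≡.sym (ℕₚ.n<1⇒n≡0 (ℕₚ.≤-trans a<∣D∣ ∣D∣≤1)) }
      ; splits = λ χ → splits (χ 0)
      }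
      where
      many : ∀ {N} → N ℕ.≤ 1 → 2 ℕ.* N ℕ.≤ 2 ℕ.^ N
      many z≤n       = z≤n
      many (s≤s z≤n) = ℕₚ.≤-refl

      splits : ∀ b → Splits D (λ _ → b) (extend D A)
      splits true = record
        { G     = extend D A
        ; H     = λ _ → 1#
        ; split = λ x → sym (*-identityʳ _)
        ; G-on  = λ x y x≡y → extend-dependsOn D A x y λ k k∈D → x≡y k (k∈D , ≡.refl)
        ; H-on  = λ _ _ _ → refl
        }
      splits false = record
        { G     = λ _ → 1#
        ; H     = extend D A
        ; split = λ x → sym (*-identityˡ _)
        ; G-on  = λ _ _ _ → refl
        ; H-on  = λ x y x≡y → extend-dependsOn D A x y λ k k∈D → x≡y k (k∈D , ≡.refl)
        }

    module _ {D E F : Subset m} (P : Partition D E F) (g : Point B → Carrier) (g-on : DependsOn (_∈ F) g) where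

      open Partition P
      open Factored

      private
        ∣D∣≤ : ∣ D ∣ ℕ.≤ ∣ E ∣ ℕ.+ ∣ F ∣
        ∣D∣≤ = subst (λ D → ∣ D ∣ ℕ.≤ ∣ E ∣ ℕ.+ ∣ F ∣) covers (∣p∪q∣≤∣p∣+∣q∣ E F)

      -- A part must contain a block, so a factor on no blocks cannot form one. Such a factor is
      -- constant and can be absorbed into G under any colouring.
      factored-scale : ∀ {f} → ¬ Nonempty F → Factored E f → Factored D (λ x → g x * f x)
      factored-scale {f} F-empty φ = record
        { parts  = parts φ
        ; label  = label φ
        ; many   = ℕₚ.≤-trans (ℕₚ.*-monoʳ-≤ 2 (ℕₚ.≤-trans ∣D∣≤ (ℕₚ.≤-reflexive ∣E∣+∣F∣≡∣E∣))) (many φ)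
        ; onto   = λ a a<K → case onto φ a a<K of λ { (k , k∈E , eq) → k , left⊆ k∈E , eq }
        ; splits = λ χ → let open Splits (splits φ χ) in record
            { G     = λ x → g x * G x
            ; H     = H
            ; split = λ x → trans (*-congˡ (split x)) (sym (*-assoc _ _ _))
            ; G-on  = λ x y x≡y → *-cong
                (g-on x y λ k k∈F → contradiction (k , k∈F) F-empty)
                (G-on x y λ { k (k∈E , eq) → x≡y k (left⊆ k∈E , eq) })
            ; H-on  = λ x y x≡y → H-on x y λ { k (k∈E , eq) → x≡y k (left⊆ k∈E , eq) }
            }
        }
        where
        ∣E∣+∣F∣≡∣E∣ : ∣ E ∣ ℕ.+ ∣ F ∣ ≡ ∣ E ∣
        ∣E∣+∣F∣≡∣E∣ = ≡.trans
          (cong (∣ E ∣ ℕ.+_) (≡.trans (cong ∣_∣ (Empty-unique F-empty)) (∣⊥∣≡0 m))) (ℕₚ.+-identityʳ _)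

      factored-multiply : ∀ {f} → Nonempty F → ∣ F ∣ ℕ.≤ ∣ E ∣ → Factored E f → Factored D (λ x → g x * f x)
      factored-multiply {f} (k₀ , k₀∈F) ∣F∣≤∣E∣ φ = record
        { parts  = suc (parts φ)
        ; label  = label′
        ; many   = ℕₚ.*-monoʳ-≤ 2 (ℕₚ.≤-trans ∣D∣≤ (ℕₚ.≤-trans (ℕₚ.+-monoʳ-≤ ∣ E ∣ ∣F∣≤∣E∣)
                     (ℕₚ.≤-trans (ℕₚ.≤-reflexive (cong (∣ E ∣ ℕ.+_) (≡.sym (ℕₚ.+-identityʳ _)))) (many φ))))
        ; onto   = onto′
        ; splits = splits′
        }
        where
        label′ : Fin m → ℕ
        label′ k with k ∈? F
        ... | yes _ = parts φ
        ... | no  _ = label φ k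

        label′-F : ∀ {k} → k ∈ F → label′ k ≡ parts φ
        label′-F {k} k∈F with k ∈? F
        ... | yes _   = ≡.refl
        ... | no  k∉F = contradiction k∈F k∉F

        label′-E : ∀ {k} → k ∈ E → label′ k ≡ label φ k
        label′-E {k} k∈E with k ∈? F
        ... | yes k∈F = contradiction (k , x∈p∩q⁺ (k∈E , k∈F)) disjoint
        ... | no  _   = ≡.refl

        onto′ : ∀ a → a ℕ.< suc (parts φ) → ∃[ k ] k ∈ D × label′ k ≡ a
        onto′ a (s≤s a≤K) with ℕₚ.m≤n⇒m<n∨m≡n a≤K
        ... | inj₂ ≡.refl = k₀ , right⊆ k₀∈F , label′-F k₀∈F
        ... | inj₁ a<K    = case onto φ a a<K of λ
              { (k , k∈E , eq) → k , left⊆ k∈E , ≡.trans (label′-E k∈E) eq }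

        splits′ : ∀ χ → Splits D (χ ∘ label′) (λ x → g x * f x)
        -- The colour of the new part decides whether g joins G or H.
        splits′ χ with χ (parts φ) in χ-new
        ... | true = record
              { G     = λ x → g x * G x
              ; H     = H
              ; split = λ x → trans (*-congˡ (split x)) (sym (*-assoc _ _ _))
              ; G-on  = λ x y x≡y → *-cong
                  (g-on x y λ k k∈F → x≡y k (right⊆ k∈F , ≡.trans (cong χ (label′-F k∈F)) χ-new))
                  (G-on x y λ { k (k∈E , eq) → x≡y k (left⊆ k∈E , ≡.trans (cong χ (label′-E k∈E)) eq) })
              ; H-on  = λ x y x≡y →
                  H-on x y λ { k (k∈E , eq) → x≡y k (left⊆ k∈E , ≡.trans (cong χ (label′-E k∈E)) eq) }
              }
          where open Splits (splits φ χ)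
        ... | false = record
              { G     = G
              ; H     = λ x → g x * H x
              ; split = λ x → trans (*-congˡ (split x)) (x∙yz≈y∙xz _ _ _)
              ; G-on  = λ x y x≡y →
                  G-on x y λ { k (k∈E , eq) → x≡y k (left⊆ k∈E , ≡.trans (cong χ (label′-E k∈E)) eq) }
              ; H-on  = λ x y x≡y → *-cong
                  (g-on x y λ k k∈F → x≡y k (right⊆ k∈F , ≡.trans (cong χ (label′-F k∈F)) χ-new))
                  (H-on x y λ { k (k∈E , eq) → x≡y k (left⊆ k∈E , ≡.trans (cong χ (label′-E k∈E)) eq) })
              }
          where open Splits (splits φ χ)

      multiply-sum : ∣ F ∣ ℕ.≤ ∣ E ∣ → ∀ {f s} → SumOf (Factored E) f s →
                     SumOf (Factored D) (λ x → g x * f x) s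
      multiply-sum ∣F∣≤∣E∣ with nonempty? F
      ... | yes F-nonempty = weighted-pullback g id λ _ → factored-multiply F-nonempty ∣F∣≤∣E∣
      ... | no  F-empty    = weighted-pullback g id λ _ → factored-scale F-empty

    extend-tensorProduct : ∀ {D E F} (P : Partition D E F) (S : Tensor B E) (T : Tensor B F) x →
                           extend D (tensorProduct P S T) x ≡ extend E S x * extend F T x
    extend-tensorProduct {D} {E} {F} P S T x = cong₂ (λ y z → S y * T z)
      (restrict-tuple (Partition.left⊆ P) x) (restrict-tuple (Partition.right⊆ P) x)

    -- Only the factor with more blocks is expanded: the other one becomes a single part,
    -- and one more part pays for going from D to a set with at least half as many blocks.
    product-sum : ∀ {D E F} (P : Partition D E F) (S : Tensor B E) (T : Tensor B F) {s t} →
                  SumOf (Factored E) (extend E S) s → SumOf (Factored F) (extend F T) t →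
                  SumOf (Factored D) (extend D (tensorProduct P S T)) (s ℕ.+ t)
    product-sum {D} {E} {F} P S T {s} {t} S-sum T-sum with ℕₚ.≤-total ∣ F ∣ ∣ E ∣
    ... | inj₁ ∣F∣≤∣E∣ = weaken (ℕₚ.m≤m+n s t) (respects
          (λ x → trans (reflexive (extend-tensorProduct P S T x)) (*-comm _ _))
          (multiply-sum P (extend F T) (extend-dependsOn F T) ∣F∣≤∣E∣ S-sum))
    ... | inj₂ ∣E∣≤∣F∣ = weaken (ℕₚ.m≤n+m t s) (respects
          (λ x → reflexive (extend-tensorProduct P S T x))
          (multiply-sum (partition-sym P) (extend E S) (extend-dependsOn E S) ∣E∣≤∣F∣ T-sum))

    -- Each leaf is one term, additions concatenate, and a product keeps the terms of only one
    -- factor.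
    formula-sum : ∀ {D} (φ : Formula B D) → SumOf (Factored D) (extend D (coefficients φ)) (leaves φ)
    formula-sum (scalar α)   = singleton (factored-small ∅ (coefficients {B = B} (scalar α))
                                 (ℕₚ.≤-trans (ℕₚ.≤-reflexive (∣⊥∣≡0 m)) z≤n))
    formula-sum (linear k v) = singleton (factored-small ⁅ k ⁆ (coefficients (linear k v))
                                 (ℕₚ.≤-reflexive (∣⁅x⁆∣≡1 k)))
    formula-sum (add t φ)    = sum-of-sums λ i → formula-sum (φ i)
    formula-sum (mul P φ ψ)  = product-sum P (coefficients φ) (coefficients ψ) (formula-sum φ) (formula-sum ψ)

    -- The same induction along a decomposition that attains the cost l; a zero tensor on one block
    -- is the empty sum, matching its cost 0.
    lsm-sum : ∀ D ac A {l} → IsLsmAcc B D ac A l → SumOf (Factored D) (extend D A) l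
    lsm-sum D (acc rec) A (inj₁ (∣D∣≡1 , _ , ≡.refl)) =
      singleton (factored-small D A (ℕₚ.≤-reflexive ∣D∣≡1))
    lsm-sum D (acc rec) A (inj₂ (inj₁ (_ , A≈0 , _))) = [] λ x → A≈0 (tuple D x)
    lsm-sum D (acc rec) A (inj₂ (inj₂ (_ , (𝒟 , b , b′ , S-cost , T-cost , ≡.refl) , _))) =
      respects (λ x → sumsToA (tuple D x)) (sum-of-sums λ i →
        product-sum (partition i) (S i) (T i)
          (lsm-sum (E i) _ (S i) (S-cost i)) (lsm-sum (F i) _ (T i) (T-cost i)))
      where open Decomposition 𝒟

  -- Low rank after a partial transposition

  -- This means rank at most one: the zero function is included.
  RankOne : ∀ {X Y : Set} → (X × Y → Carrier) → Set (c ⊔ ℓ₁)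
  RankOne {X} {Y} F = Σ[ R ∈ (X → Carrier) ] Σ[ C ∈ (Y → Carrier) ] (∀ x y → F (x , y) ≈ R x * C y)

  -- Columns enter G only through the positions e with colours e ≡ (true , true); fixing
  -- their values by a sum over δ's makes G a function of the row alone.  Likewise for H.
  rank-one-terms : ∀ {n d} → Vec (Fin n) d → (colours : Fin d → Bool × Bool) →
    ∀ es (G H : Vec (Fin n) d → Vec (Fin n) d → Carrier) →
    (∀ a b b′ → AgreeOn (λ e → colours e ≡ (true  , true))  es b b′ → G a b ≈ G a b′) →
    (∀ a a′ b → AgreeOn (λ e → colours e ≡ (false , false)) es a a′ → H a b ≈ H a′ b) →
    SumOf RankOne (λ (a , b) → G a b * H a b)
      (n ℕ.^ ListAction.sum (List.map (uncurry agree ∘ colours) es))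
  -- With no position left, G ignores the column and H the row; o fills the ignored argument.
  rank-one-terms o colours [] G H G-on H-on = singleton
    ((λ a → G a o) , (λ b → H o b) , λ a b → *-cong (G-on a b o λ _ ()) (H-on a o b λ _ ()))
  rank-one-terms {n} {d} o colours (e ∷ es) G H G-on H-on = step (colours e) ≡.refl
    where
    rest : ∀ (G H : Vec (Fin n) d → Vec (Fin n) d → Carrier) → _
    rest = rank-one-terms o colours es

    excluded : ∀ {x y} → colours e ≡ x → x ≢ y → colours e ≢ y
    excluded eq x≢y eq′ = x≢y (≡.trans (≡.sym eq) eq′)

    step : ∀ x → colours e ≡ x → SumOf RankOne (λ (a , b) → G a b * H a b)
             (n ℕ.^ (uncurry agree x ℕ.+ ListAction.sum (List.map (uncurry agree ∘ colours) es)))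
    -- At a bichromatic position neither function has an unwanted dependence, so no factor n is
    -- paid.
    step (true , false) eq = rest G H
      (λ a b b′ same → G-on a b b′ (agreeOn-∷ b b′ (excluded eq λ ()) same))
      (λ a a′ b same → H-on a a′ b (agreeOn-∷ a a′ (excluded eq λ ()) same))
    step (false , true) eq = rest G H
      (λ a b b′ same → G-on a b b′ (agreeOn-∷ b b′ (excluded eq λ ()) same))
      (λ a a′ b same → H-on a a′ b (agreeOn-∷ a a′ (excluded eq λ ()) same))
    -- The column entry at e is summed over its n values v. G then sees the constant v, and the δ
    -- depends on the column alone, so it joins C.
    step (true , true) eq = weaken (ℕₚ.≤-reflexive (sumℕ-const n _)) (respects
      (λ (a , b) → sym (trans (sum-δ (lookup b e) λ v → G a (b [ e ]≔ v) * H a b)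
                              (*-congʳ (reflexive (cong (G a) ([]≔-lookup b e))))))
      (sum-of-sums λ v → weighted-pullback (λ (a , b) → δ (lookup b e) v) id
        (λ { _ (R , C , split) → R , (λ b → δ (lookup b e) v * C b) ,
             λ a b → trans (*-congˡ (split a b)) (x∙yz≈y∙xz _ _ _) })
        (rest (λ a b → G a (b [ e ]≔ v)) H
          (λ a b b′ same → G-on a _ _ (agreeOn-update b b′ same))
          (λ a a′ b same → H-on a a′ b (agreeOn-∷ a a′ (excluded eq λ ()) same)))))
    step (false , false) eq = weaken (ℕₚ.≤-reflexive (sumℕ-const n _)) (respects
      (λ (a , b) → sym (trans (sum-δ (lookup a e) λ v → G a b * H (a [ e ]≔ v) b)
                              (*-congˡ (reflexive (cong (λ a → H a b) ([]≔-lookup a e))))))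
      (sum-of-sums λ v → weighted-pullback (λ (a , b) → δ (lookup a e) v) id
        (λ { _ (R , C , split) → (λ a → δ (lookup a e) v * R a) , C ,
             λ a b → trans (*-congˡ (split a b)) (sym (*-assoc _ _ _)) })
        (rest G (λ a b → H (a [ e ]≔ v) b)
          (λ a b b′ same → G-on a b b′ (agreeOn-∷ b b′ (excluded eq λ ()) same))
          (λ a a′ b same → H-on _ _ b (agreeOn-update a a′ same)))))

  -- PT-basic matrices and PT-rank.

  module _ {n d : ℕ} where

    Index : Set
    Index = Vec (Fin n) d

    -- Since `mix` is an involution, this says that the transpose along κ is R a * C b at (a , b).
    -- Zero is allowed here, in contrast to `PTBasic`.
    LowRank : (Index × Index → Carrier) → Set (c ⊔ ℓ₁)
    LowRank N = Σ[ κ ∈ Subset d ] Σ[ R ∈ (Index → Carrier) ] Σ[ C ∈ (Index → Carrier) ]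
      (∀ i j → N (i , j) ≈ R (mix κ i j) * C (mix κ j i))

    transpose-mix : ∀ (M : Matrix n d) κ i j → (M ^⊤ κ) i j ≡ M (mix κ i j) (mix κ j i)
    transpose-mix M κ i j = ≡.trans (along (allFin d) i j)
      (cong₂ M (swaps-allFin κ i j) (swaps-allFin κ j i))
      where
      along : ∀ l i j →
        List.foldr (λ k N → if lookup κ k then partialTranspose k N else N) M l i j
          ≡ M (swaps κ l i j) (swaps κ l j i)
      along []      i j = ≡.refl
      along (k ∷ l) i j with lookup κ k
      ... | true  = along l _ _
      ... | false = along l i j

    IsPTBasic : (Index × Index → Carrier) → Set (c ⊔ ℓ₁)
    IsPTBasic N = PTBasic λ i j → N (i , j)

    -- The column through an invertible entry is independent, and any two columns of R a * C b are
    -- proportional.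
    lowRank⇒basic : ∀ {N} → LowRank N → ∀ i j → N (i , j) # 0# → IsPTBasic N
    lowRank⇒basic {N} (κ , R , C , N≈) i j N#0 =
      κ , (((λ _ → b₀) , independent) , at-most-one)
      where
      a₀ b₀ : Index
      a₀ = mix κ i j
      b₀ = mix κ j i

      T : Matrix n d
      T = (λ i j → N (i , j)) ^⊤ κ

      T₀≡ : T a₀ b₀ ≡ N (i , j)
      T₀≡ = ≡.trans (transpose-mix _ κ a₀ b₀)
        (cong₂ (λ i j → N (i , j)) (mix-involutive κ i j) (mix-involutive κ j i))

      T≈ : ∀ a b → T a b ≈ R a * C b
      T≈ a b = trans (reflexive (transpose-mix _ κ a b)) (trans (N≈ _ _)
        (reflexive (cong₂ (λ a b → R a * C b) (mix-involutive κ a b) (mix-involutive κ b a))))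

      independent : LinearlyIndependent {s = 1} (λ _ a → T a b₀)
      independent α α·T≈0 zero with #⇒invertible N#0
      ... | y , _ , N-0*y≈1 = begin
        α zero                                ≈⟨ *-identityʳ _ ⟨
        α zero * 1#                           ≈⟨ *-congˡ N-0*y≈1 ⟨
        α zero * ((N (i , j) - 0#) * y)       ≈⟨ *-assoc _ _ _ ⟨
        α zero * (N (i , j) - 0#) * y         ≈⟨ *-congʳ (*-congˡ (x-0≈x _)) ⟩
        α zero * N (i , j) * y                ≈⟨ *-congʳ (*-congˡ (reflexive T₀≡)) ⟨
        α zero * T a₀ b₀ * y                  ≈⟨ *-congʳ (+-identityʳ _) ⟨
        (α zero * T a₀ b₀ + 0#) * y           ≈⟨ *-congʳ (α·T≈0 a₀) ⟩
        0# * y                                ≈⟨ zeroˡ y ⟩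
        0#                                    ∎

      at-most-one : ∀ s (cols : Fin s → Index) → LinearlyIndependent (λ k a → T a (cols k)) → s ℕ.≤ 1
      at-most-one zero          cols _     = z≤n
      at-most-one (suc zero)    cols _     = ℕₚ.≤-refl
      at-most-one (suc (suc s)) cols indep = ⊥-elim (proj₂ (tight 1# 0#) 1≈0 1#0)
        where
        b₁ b₂ : Index
        b₁ = cols zero
        b₂ = cols (suc zero)

        rest≈0 : ∀ a → sum {s} (λ k → 0# * T a (cols (suc (suc k)))) ≈ 0#
        rest≈0 a = sum-zero {s} λ k → zeroˡ _

        -- The relation α expresses proportionality of the first two columns and forces C b₂ ≈ 0.
        -- Column b₂ then vanishes, so the unit vector β is a relation too and forces 1 ≈ 0.
        α β : Fin (suc (suc s)) → Carrier
        α zero          = C b₂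
        α (suc zero)    = - C b₁
        α (suc (suc _)) = 0#
        β zero          = 0#
        β (suc zero)    = 1#
        β (suc (suc _)) = 0#

        cross : ∀ a → C b₂ * T a b₁ ≈ C b₁ * T a b₂
        cross a = begin
          C b₂ * T a b₁          ≈⟨ *-congˡ (T≈ a b₁) ⟩
          C b₂ * (R a * C b₁)    ≈⟨ x∙yz≈y∙xz _ _ _ ⟩
          R a * (C b₂ * C b₁)    ≈⟨ *-congˡ (*-comm _ _) ⟩
          R a * (C b₁ * C b₂)    ≈⟨ x∙yz≈y∙xz _ _ _ ⟩
          C b₁ * (R a * C b₂)    ≈⟨ *-congˡ (T≈ a b₂) ⟨
          C b₁ * T a b₂          ∎

        C₂≈0 : C b₂ ≈ 0#
        C₂≈0 = indep α (λ a → begin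
          C b₂ * T a b₁ + (- C b₁ * T a b₂ + _)
            ≈⟨ +-cong (cross a) (+-cong (sym (-‿distribˡ-* _ _)) (rest≈0 a)) ⟩
          C b₁ * T a b₂ + (- (C b₁ * T a b₂) + 0#)      ≈⟨ +-congˡ (+-identityʳ _) ⟩
          C b₁ * T a b₂ - C b₁ * T a b₂                 ≈⟨ -‿inverseʳ _ ⟩
          0#                                            ∎) zero

        1≈0 : 1# ≈ 0#
        1≈0 = indep β (λ a → begin
          0# * T a b₁ + (1# * T a b₂ + _)     ≈⟨ +-cong (zeroˡ _) (+-cong (*-identityˡ _) (rest≈0 a)) ⟩
          0# + (T a b₂ + 0#)                  ≈⟨ trans (+-identityˡ _) (+-identityʳ _) ⟩
          T a b₂                              ≈⟨ T≈ a b₂ ⟩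
          R a * C b₂                          ≈⟨ *-congˡ C₂≈0 ⟩
          R a * 0#                            ≈⟨ zeroʳ _ ⟩
          0#                                  ∎) (suc zero)

    -- PT-basic matrices have rank exactly 1, so zero terms must be dropped; whether a term
    -- is zero is undecidable, hence the double negation.
    lowRank⇒basic-sum : ∀ {N s} → SumOf LowRank N s → ¬ ¬ SumOf IsPTBasic N s
    lowRank⇒basic-sum ([] N≈0) ¬sum = ¬sum ([] N≈0)
    lowRank⇒basic-sum (cons {f} {g} {h} low hs N≈) ¬sum = ¬¬-excluded-middle λ where
      (yes basic) → lowRank⇒basic-sum hs λ hs′ → ¬sum (cons basic hs′ N≈)
      (no ¬basic) → lowRank⇒basic-sum hs λ hs′ → ¬sum (weaken (ℕₚ.n≤1+n _) (respects
        (λ { (i , j) → trans (N≈ (i , j)) (trans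
          (+-congʳ (proj₁ (tight _ _) λ g#0 → ¬basic (lowRank⇒basic low i j g#0))) (+-identityˡ _)) }) hs′))

  as-finite-sum : ∀ {X : Set} {P : (X → Carrier) → Set p} {f s} → SumOf P f s →
    Σ[ t ∈ ℕ ] t ℕ.≤ s × Σ[ g ∈ (Fin t → X → Carrier) ] (∀ k → P (g k)) × (∀ x → f x ≈ sum (λ k → g k x))
  as-finite-sum ([] f≈0) = 0 , z≤n , (λ ()) , (λ ()) , f≈0
  as-finite-sum (cons {g = g} Pg hs f≈) with as-finite-sum hs
  ... | t , t≤s , gs , Pgs , h≈ = suc t , s≤s t≤s , (λ { zero → g ; (suc k) → gs k }) ,
        (λ { zero → Pg ; (suc k) → Pgs k }) , λ x → trans (f≈ x) (+-congˡ (h≈ x))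

  -- A comparison of natural numbers is decidable, hence stable, so the doubly negated decomposition
  -- is enough.
  ptRank≤ : ∀ {M : Matrix n d} {r s} → IsPTRank M r → SumOf LowRank (λ (i , j) → M i j) s → r ℕ.≤ s
  ptRank≤ {r = r} {s} (_ , minimal) low = decidable-stable (r ℕₚ.≤? s) (¬¬-map bound (lowRank⇒basic-sum low))
    where
    bound : _ → r ℕ.≤ s
    bound basic with as-finite-sum basic
    ... | t , t≤s , N , basics , M≈ =
          ℕₚ.≤-trans (minimal t ((λ k i j → N k (i , j)) , basics , λ i j → M≈ (i , j))) t≤s

  -- The paper's indices i_{k+1} and j_k are at the 0-based positions k and k − 1, so block k
  -- of the shifted tensor contains i at e with inject₁ e ≡ k and j at e with suc e ≡ k.
  module _ {n d : ℕ} .{{_ : NonZero n}} {B : Fin (suc d) → Set}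
    (point : Vec (Fin n) d → Vec (Fin n) d → Point B)
    (local : ∀ i j i′ j′ k → (∀ e → inject₁ e ≡ k → lookup i e ≡ lookup i′ e) →
             (∀ e → suc e ≡ k → lookup j e ≡ lookup j′ e) → point i j k ≡ point i′ j′ k)
    where

    -- In transposed coordinates G sees the column only at edges coloured (true , true), and H the
    -- row only at edges coloured (false , false). Together these are the monochromatic edges, which
    -- gives the exponent.
    splits⇒lowRank : ∀ colour {f} → Splits Full colour f →
                     SumOf LowRank (λ (i , j) → f (point i j)) (n ℕ.^ monochromatic colour)
    splits⇒lowRank colour {f} S = subst (SumOf LowRank _) exponent (respects
      (λ (i , j) → reflexive (cong f (≡.sym (cong₂ point (mix-involutive κ i j) (mix-involutive κ j i)))))
      (pullback (λ (i , j) → mix κ i j , mix κ j i)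
        (λ { _ (R , C , F≈) → singleton (κ , R , C , λ i j → F≈ (mix κ i j) (mix κ j i)) })
        (respects {f = λ (a , b) → G (mixed a b) * H (mixed a b)} (λ (a , b) → split (mixed a b))
          (rank-one-terms (Vec.replicate d (any-index n)) colours (allFin d)
            (λ a b → G (mixed a b)) (λ a b → H (mixed a b)) G-columns H-rows))))
      where
      open Splits S

      colours : Fin d → Bool × Bool
      colours e = colour (inject₁ e) , colour (suc e)

      -- Transposing where the colours of j_e and i_e are the wrong way round makes every
      -- two-coloured pair have its true end among the rows.
      κ : Subset d
      κ = Vec.tabulate λ e → not (colour (inject₁ e)) ∧ colour (suc e)

      mixed : Vec (Fin n) d → Vec (Fin n) d → Point B
      mixed a b = point (mix κ a b) (mix κ b a)

      κ-at : ∀ e {x y} → colour (inject₁ e) ≡ x → colour (suc e) ≡ y → lookup κ e ≡ not x ∧ y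
      κ-at e eq₁ eq₂ = ≡.trans (lookup∘tabulate _ e) (cong₂ (λ x y → not x ∧ y) eq₁ eq₂)

      any-index : ∀ n → .{{NonZero n}} → Fin n
      any-index (suc n) = zero

      exponent : n ℕ.^ ListAction.sum (List.map (uncurry agree ∘ colours) (allFin d)) ℕ.* 1
                   ≡ n ℕ.^ monochromatic colour
      exponent = ≡.trans (ℕₚ.*-identityʳ _) (cong (n ℕ.^_) (sum-map-tabulate (uncurry agree ∘ colours) id))

      G-columns : ∀ a b b′ → AgreeOn (λ e → colours e ≡ (true , true)) (allFin d) b b′ →
                  G (mixed a b) ≈ G (mixed a b′)
      G-columns a b b′ same = G-on _ _ λ k (_ , true-k) → local _ _ _ _ k
        (λ { e ≡.refl → ≡.trans (lookup-mix-false κ {a} {b} (κ-at e true-k ≡.refl))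
                                (≡.sym (lookup-mix-false κ {a} {b′} (κ-at e true-k ≡.refl))) })
        -- The index j_e stays in the column only if the other end of the edge is true as well,
        -- where `same` applies; otherwise κ has moved it to the row.
        (λ { e ≡.refl → column e true-k (colour (inject₁ e)) ≡.refl })
        where
        column : ∀ e → colour (suc e) ≡ true → ∀ x → colour (inject₁ e) ≡ x →
                 lookup (mix κ b a) e ≡ lookup (mix κ b′ a) e
        column e eq₂ true  eq₁ = ≡.trans (lookup-mix-false κ {b} {a} (κ-at e eq₁ eq₂))
          (≡.trans (same e (∈-allFin e) (cong₂ _,_ eq₁ eq₂))
            (≡.sym (lookup-mix-false κ {b′} {a} (κ-at e eq₁ eq₂))))
        column e eq₂ false eq₁ = ≡.trans (lookup-mix-true κ {b} {a} (κ-at e eq₁ eq₂))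
          (≡.sym (lookup-mix-true κ {b′} {a} (κ-at e eq₁ eq₂)))

      H-rows : ∀ a a′ b → AgreeOn (λ e → colours e ≡ (false , false)) (allFin d) a a′ →
               H (mixed a b) ≈ H (mixed a′ b)
      H-rows a a′ b same = H-on _ _ λ k (_ , false-k) → local _ _ _ _ k
        -- Dually, i_e stays in the row only if both ends of the edge are false.
        (λ { e ≡.refl → row e false-k (colour (suc e)) ≡.refl })
        (λ { e ≡.refl → ≡.trans (lookup-mix-false κ {b} {a} (κ-false e false-k))
                                (≡.sym (lookup-mix-false κ {b} {a′} (κ-false e false-k))) })
        where
        κ-false : ∀ e → colour (suc e) ≡ false → lookup κ e ≡ false
        κ-false e eq₂ = ≡.trans (κ-at e ≡.refl eq₂) (∧-zeroʳ _)

        row : ∀ e → colour (inject₁ e) ≡ false → ∀ y → colour (suc e) ≡ y →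
              lookup (mix κ a b) e ≡ lookup (mix κ a′ b) e
        row e eq₁ true  eq₂ = ≡.trans (lookup-mix-true κ {a} {b} (κ-at e eq₁ eq₂))
          (≡.sym (lookup-mix-true κ {a′} {b} (κ-at e eq₁ eq₂)))
        row e eq₁ false eq₂ = ≡.trans (lookup-mix-false κ {a} {b} (κ-at e eq₁ eq₂))
          (≡.trans (same e (∈-allFin e) (cong₂ _,_ eq₁ eq₂))
            (≡.sym (lookup-mix-false κ {a′} {b} (κ-at e eq₁ eq₂))))

    -- By `many` and the minimality of K there are at least K parts, so some colouring of them
    -- leaves at most d + 1 - K monochromatic edges.
    factored⇒lowRank : ∀ {K} → (∀ K′ → 2 ℕ.* suc d ℕ.≤ 2 ℕ.^ K′ → K ℕ.≤ K′) → ∀ {f} → Factored Full f →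
                       SumOf LowRank (λ (i , j) → f (point i j)) (n ℕ.^ (suc d ℕ.∸ K))
    factored⇒lowRank {K} least φ
      with few-monochromatic (Factored.label φ) (λ a a<K → map₂ proj₂ (Factored.onto φ a a<K))
    ... | χ , bound = weaken
          (ℕₚ.^-monoʳ-≤ n (ℕₚ.m+n≤o⇒m≤o∸n (monochromatic (χ ∘ label)) (ℕₚ.≤-trans
            (ℕₚ.+-monoʳ-≤ _ (least parts (subst (λ x → 2 ℕ.* x ℕ.≤ 2 ℕ.^ parts) (∣⊤∣≡n (suc d)) many))) bound)))
          (splits⇒lowRank (χ ∘ label) (splits χ))
      where open Factored φ

    ptRank-bound : ∀ {M : Matrix n d} {r} → IsPTRank M r → ∀ {f l} → (∀ i j → M i j ≈ f (point i j)) →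
                   SumOf (Factored Full) f l → r / n ^[ d -log₂ d +1]≤ l
    ptRank-bound isRank {l = l} M≈f f-sum with least-power (2 ℕ.* suc d)
    ... | K , 2[1+d]≤2^K , least = clear-root {l = l}
          -- Since d + 1 ≤ 2^d, also 2 (d + 1) ≤ 2^(d + 1). Hence K ≤ d + 1, and the truncated
          -- subtraction is exact.
          (least (suc d) (ℕₚ.*-monoʳ-≤ 2 (n<2^n d)))
          (ℕₚ.≤-trans (ℕₚ.≤-trans (ℕₚ.n≤1+n d) (ℕₚ.m≤m+n (suc d) _)) 2[1+d]≤2^K)
          (ptRank≤ isRank (respects (λ (i , j) → M≈f i j)
            (pullback (λ (i , j) → point i j) (λ _ → factored⇒lowRank least) f-sum)))

  -- The points of the two encodings of the blocks

  -- A section of `rowColumnFrom`: each column index is handed on as the left component of the next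
  -- block.
  blockPoint : ∀ {L} d → L → Vec (Fin n) d → Vec (Fin n) d → Point (BlocksFrom L n d)
  blockPoint zero    l []       []       zero    = l
  blockPoint (suc d) l (i ∷ is) js       zero    = l , i
  blockPoint (suc d) l (i ∷ is) (j ∷ js) (suc k) = blockPoint d j is js k

  rowColumnFrom-blockPoint : ∀ {L} d (l : L) (is js : Vec (Fin n) d) →
    rowColumnFrom d (tuple Full (blockPoint d l is js)) ≡ (l , is , js)
  rowColumnFrom-blockPoint zero    l []       []       = ≡.refl
  rowColumnFrom-blockPoint (suc d) l (i ∷ is) (j ∷ js)
    rewrite rowColumnFrom-blockPoint d j is js = ≡.refl

  -- The left component varies for the sake of the induction, where the head of j takes its place.
  blockPoint-local : ∀ {L} d {l l′ : L} (i j i′ j′ : Vec (Fin n) d) k → (k ≡ zero → l ≡ l′) →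
    (∀ e → inject₁ e ≡ k → lookup i e ≡ lookup i′ e) → (∀ e → suc e ≡ k → lookup j e ≡ lookup j′ e) →
    blockPoint d l i j k ≡ blockPoint d l′ i′ j′ k
  blockPoint-local zero    [] [] [] [] zero l≡ i≡ j≡ = l≡ ≡.refl
  blockPoint-local (suc d) (_ ∷ _) (_ ∷ _) (_ ∷ _) (_ ∷ _) zero l≡ i≡ j≡ =
    cong₂ _,_ (l≡ ≡.refl) (i≡ zero ≡.refl)
  blockPoint-local (suc d) (_ ∷ is) (_ ∷ js) (_ ∷ is′) (_ ∷ js′) (suc k) l≡ i≡ j≡ =
    blockPoint-local d is js is′ js′ k (λ { ≡.refl → j≡ zero ≡.refl })
      (λ e eq → i≡ (suc e) (cong suc eq)) (λ e eq → j≡ (suc e) (cong suc eq))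

  lookup-∷ʳ-local : ∀ {A : Set} (i i′ : Vec A d) z k → (∀ e → inject₁ e ≡ k → lookup i e ≡ lookup i′ e) →
                    lookup (i ∷ʳ z) k ≡ lookup (i′ ∷ʳ z) k
  lookup-∷ʳ-local []      []        z k       eq = ≡.refl
  lookup-∷ʳ-local (x ∷ i) (x′ ∷ i′) z zero    eq = eq zero ≡.refl
  lookup-∷ʳ-local (x ∷ i) (x′ ∷ i′) z (suc k) eq = lookup-∷ʳ-local i i′ z k λ e eq′ → eq (suc e) (cong suc eq′)

  -- The padding zeros are the end values p = q = 1 in 0-based form, and `combine` is the pairing.
  pairPoint : Vec (Fin (suc n)) d → Vec (Fin (suc n)) d → Point {suc d} (λ _ → Fin (suc n ℕ.* suc n))
  pairPoint i j k = combine (lookup (zero ∷ j) k) (lookup (i ∷ʳ zero) k)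

  pairPoint-local : ∀ (i j i′ j′ : Vec (Fin (suc n)) d) k →
    (∀ e → inject₁ e ≡ k → lookup i e ≡ lookup i′ e) → (∀ e → suc e ≡ k → lookup j e ≡ lookup j′ e) →
    pairPoint i j k ≡ pairPoint i′ j′ k
  pairPoint-local i j i′ j′ k i≡ j≡ = cong₂ combine (left k j≡) (lookup-∷ʳ-local i i′ zero k i≡)
    where
    left : ∀ k → (∀ e → suc e ≡ k → lookup j e ≡ lookup j′ e) → lookup (zero ∷ j) k ≡ lookup (zero ∷ j′) k
    left zero    eq = ≡.refl
    left (suc e) eq = eq e ≡.refl

  lookup-fullTuple : ∀ {m} {X : Set} (x : Fin m → X) k → lookup (fullTuple (tuple Full x)) k ≡ x k
  lookup-fullTuple x zero    = ≡.refl
  lookup-fullTuple x (suc k) = lookup-fullTuple (x ∘ suc) k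

  shiftedTensor-pairPoint : ∀ (M : Matrix (suc n) d) i j →
                            ShiftedTensor M (tuple Full (pairPoint i j)) ≡ M i j
  shiftedTensor-pairPoint {n} {d} M i j = ≡.trans (cong₂ entry firsts≡ seconds≡) entry-padded
    where
    -- The body of `ShiftedTensor` as a function of its two coordinate vectors, so that each can be
    -- replaced by its padded form.
    entry : Vec (Fin (suc n)) (suc d) → Vec (Fin (suc n)) (suc d) → Carrier
    entry f s = if ⌊ toℕ (head f) ℕₚ.≟ 0 ⌋
      then (if ⌊ toℕ (last s) ℕₚ.≟ 0 ⌋ then M (init s) (tail f) else 0#) else 0#

    entry-padded : entry (zero ∷ j) (i ∷ʳ zero) ≡ M i j
    entry-padded rewrite last-∷ʳ (zero {n}) i | init-∷ʳ (zero {n}) i = ≡.refl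

    pairs : Vec (Fin (suc n) × Fin (suc n)) (suc d)
    pairs = Vec.map (remQuot (suc n)) (fullTuple (tuple Full (pairPoint i j)))

    lookup-pairs : ∀ k → lookup pairs k ≡ (lookup (zero ∷ j) k , lookup (i ∷ʳ zero) k)
    lookup-pairs k = ≡.trans (lookup-map k (remQuot (suc n)) (fullTuple (tuple Full (pairPoint i j))))
      (≡.trans (cong (remQuot (suc n)) (lookup-fullTuple (pairPoint i j) k)) (remQuot-combine _ _))

    firsts≡ : Vec.map proj₁ pairs ≡ zero ∷ j
    firsts≡ = vec-ext λ k → ≡.trans (lookup-map k proj₁ pairs) (cong proj₁ (lookup-pairs k))

    seconds≡ : Vec.map proj₂ pairs ≡ i ∷ʳ zero
    seconds≡ = vec-ext λ k → ≡.trans (lookup-map k proj₂ pairs) (cong proj₂ (lookup-pairs k))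

open import Data.Nat.Base using (_*_)

theorem1p4 : ∀ {c ℓ₁ ℓ₂} (𝔽 : HeytingField c ℓ₁ ℓ₂) → let open OverField 𝔽 in
    ∀ n d → .{{_ : NonZero n}} → .{{_ : NonZero d}} →
    (M : Matrix n d) (r : ℕ) → IsPTRank M r →
    (∀ l → IsLsm (λ _ → Fin (n * n)) (Full {suc d}) (ShiftedTensor M) l → r / n ^[ d -log₂ d +1]≤ l) ×
    ((φ : Formula (Blocks n d) Full) → Computes φ (Q̃ M) → r / n ^[ d -log₂ d +1]≤ leaves φ)
theorem1p4 𝔽 (suc n) d M r isRank =
  -- The entries of M are values of the tensor at chosen points, so a decomposition of the tensor
  -- restricts to one of M.
  (λ l isLsm → ptRank-bound pairPoint pairPoint-local isRank
    (λ i j → reflexive (≡.sym (shiftedTensor-pairPoint M i j)))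
    (lsm-sum Full (<-wellFounded _) (ShiftedTensor M) isLsm)) ,
  (λ φ computes → ptRank-bound (blockPoint d tt)
    (λ i j i′ j′ k → blockPoint-local d i j i′ j′ k λ _ → ≡.refl) isRank
    (λ i j → trans (reflexive (cong (uncurry M ∘ proj₂) (≡.sym (rowColumnFrom-blockPoint d tt i j))))
      (sym (computes _)))
    (formula-sum φ))
  where
  open OverField 𝔽
  open LowerBound 𝔽
  open CommutativeRing (HeytingCommutativeRing.commutativeRing (HeytingField.heytingCommutativeRing 𝔽))
    using (reflexive; trans; sym)
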